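{- Let $G$ be a minimally $1$-tough graph of order $n$ and girth $g \ge 5$. Then $G$ has a vertex of degree at most $\left\lfloor \frac{n}{g+1} \right\rfloor + g - 1$.
   Context: All graphs are finite, simple and undirected. The order $n$ of a graph is its number of vertices; the girth $g$ is the length of a shortest cycle. For a graph $G$ and $S\subseteq V(G)$, $w(G-S)$ denotes the number of connected components of $G-S$. The toughness of a noncomplete graph $G$ is $\tau(G)=\min\left\{\frac{|S|}{w(G-S)} : S\subseteq V(G),\ w(G-S)\ge 2\right\}$, and $\tau(G)=+\infty$ if $G$ is complete. A graph $G$ is minimally $t$-tough if $\tau(G)=t$ and $\tau(G-e)<t$ for every edge $e\in E(G)$, where $G-e$ is $G$ with the edge $e$ deleted. -}

module Defs where

open import Level using (0ℓ)
open import Data.Nat.Base as ℕ using (ℕ; suc; z<s; >-nonZero)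
import Data.Nat.Properties as ℕ
open import Data.Integer.Base using (+_)
open import Data.Rational.Base as ℚ using (ℚ)
open import Data.Fin.Base using (Fin; toℕ)
open import Data.Fin.Properties using (_≟_)
open import Data.Fin.Subset using (Subset; ∣_∣; _∉_)
open import Data.Vec.Base using (tabulate)
open import Data.Product.Base using (∃; _×_; _,_; proj₁)
open import Data.Sum.Base using (_⊎_; inj₁; inj₂)
open import Function.Base using (_∘_)
open import Function.Bundles using (Bijection)
open import Function.Definitions using (Injective)
open import Relation.Nullary.Negation.Core using (¬_)
open import Relation.Nullary.Decidable
  using (does; ¬?; _×-dec_; _⊎-dec_)
open import Relation.Nullary.Construct.Add.Supremum using (_⁺; ⊤⁺; [_])
open import Relation.Binary.Core using (Rel)
open import Relation.Binary.Bundles using (Setoid)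
open import Relation.Binary.Definitions
  using (Decidable; Symmetric; Irreflexive)
open import Relation.Binary.PropositionalEquality
  using (_≡_; _≢_) renaming (setoid to ≡-setoid)
open import Relation.Binary.Construct.Closure.ReflexiveTransitive
  using (Star; ε; _◅◅_; reverse)
import Relation.Binary.Construct.On as On
open import Relation.Binary.Construct.Add.Supremum.Strict ℚ._<_ public
  using (_<⁺_)

-- Finite simple undirected graphs of order n, on the vertex set Fin n.
record Graph (n : ℕ) : Set₁ where
  field
    Adj    : Rel (Fin n) 0ℓ
    adj?   : Decidable Adj
    sym    : Symmetric Adj
    irrefl : Irreflexive _≡_ Adj

open Graph public

Complete : ∀ {n} → Graph n → Set
Complete G = ∀ u v → u ≢ v → Adj G u v

neighbours : ∀ {n} → Graph n → Fin n → Subset n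
neighbours G v = tabulate (λ u → does (adj? G v u))

degree : ∀ {n} → Graph n → Fin n → ℕ
degree G v = ∣ neighbours G v ∣

SameEdge : ∀ {n} (u v x y : Fin n) → Set
SameEdge u v x y = (x ≡ u × y ≡ v) ⊎ (x ≡ v × y ≡ u)

deleteEdge : ∀ {n} → Graph n → Fin n → Fin n → Graph n
deleteEdge G u v = record
  { Adj    = λ x y → Adj G x y × ¬ SameEdge u v x y
  ; adj?   = λ x y → adj? G x y ×-dec
               ¬? (((x ≟ u) ×-dec (y ≟ v)) ⊎-dec ((x ≟ v) ×-dec (y ≟ u)))
  ; sym    = λ (xy , kept) → sym G xy , kept ∘ flipEdge
  ; irrefl = λ x≡y (xy , _) → irrefl G x≡y xy
  }
  where
  flipEdge : ∀ {x y} → SameEdge u v y x → SameEdge u v x y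
  flipEdge (inj₁ (y≡u , x≡v)) = inj₂ (x≡v , y≡u)
  flipEdge (inj₂ (y≡v , x≡u)) = inj₁ (x≡u , y≡v)

record Cycle {n} (G : Graph n) (k : ℕ) : Set where
  field
    3≤length : 3 ℕ.≤ k
    vertex   : Fin k → Fin n
    distinct : Injective _≡_ _≡_ vertex
    step     : ∀ i j → toℕ j ≡ suc (toℕ i) → Adj G (vertex i) (vertex j)
    close    : ∀ i j → suc (toℕ i) ≡ k → toℕ j ≡ 0 →
               Adj G (vertex i) (vertex j)

HasGirth : ∀ {n} → Graph n → ℕ → Set
HasGirth G g = Cycle G g × (∀ k → Cycle G k → g ℕ.≤ k)

AdjOutside : ∀ {n} → Graph n → Subset n → Rel (Fin n) 0ℓ
AdjOutside G S u v = u ∉ S × v ∉ S × Adj G u v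

-- The vertices of G - S, with "joined by a walk in G - S" as equality, so
-- that the elements up to _≈_ are the components of G - S.  Walks live on
-- Fin n rather than on the pairs (v , v∉S), so that they do not distinguish
-- between different proofs of v ∉ S.
components : ∀ {n} → Graph n → Subset n → Setoid 0ℓ 0ℓ
components {n} G S = On.setoid walks (proj₁ {B = _∉ S})
  where
  walks : Setoid 0ℓ 0ℓ
  walks = record
    { Carrier       = Fin n
    ; _≈_           = Star (AdjOutside G S)
    ; isEquivalence = record
      { refl  = ε
      ; sym   = reverse (λ (u∉S , v∉S , uv) → v∉S , u∉S , sym G uv)
      ; trans = _◅◅_
      }
    }

-- w(G - S) = k
HasComponents : ∀ {n} → Graph n → Subset n → ℕ → Set
HasComponents G S k = Bijection (components G S) (≡-setoid (Fin k))

-- q = |S| / w(G - S) for some S with w(G - S) ≥ 2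
record CutRatio {n} (G : Graph n) (q : ℚ) : Set where
  field
    S       : Subset n
    w       : ℕ
    w-count : HasComponents G S w
    2≤w     : 2 ℕ.≤ w
    ratio   : q ≡ (+ ∣ S ∣ ℚ./ w) {{>-nonZero (ℕ.<-trans z<s 2≤w)}}

-- τ(G) = t, where ⊤⁺ is +∞
HasToughness : ∀ {n} → Graph n → ℚ ⁺ → Set
HasToughness G ⊤⁺    = Complete G
HasToughness G [ q ] =
  ¬ Complete G × CutRatio G q × (∀ r → CutRatio G r → q ℚ.≤ r)

MinimallyTough : ∀ {n} → Graph n → ℚ → Set
MinimallyTough G t =
  HasToughness G [ t ] ×
  (∀ u v → Adj G u v →
    ∃ λ s → HasToughness (deleteEdge G u v) s × s <⁺ [ t ])

-- Girth at least 5 excludes 4-cycles, so if every degree is at least d then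
-- d (d - 1) ≤ n: fix a vertex and count the vertices at the end of paths of
-- length 2 from it.  But with q = ⌊n / (g + 1)⌋ and d = q + g this product is at
-- least (q + 1)(g + 1), which exceeds n.
module Submission where

open import Defs
open import Data.Nat using (ℕ; suc; _+_; _*_; _∸_; _≤_; _<_; _/_; _≤?_; z≤n; s≤s)
open import Data.Nat.Properties
  using (≤-trans; +-suc; m≤m+n; ≰⇒>; <⇒≱; +-monoˡ-<)
open import Data.Nat.DivMod using (m≡m%n+[m/n]*n; m%n<n)
open import Data.Nat.Tactic.RingSolver using (solve-∀)
open import Data.Bool.Base using (true; false)
open import Data.Fin using (Fin; zero; suc; punchIn; toℕ; remQuot; combine; fromℕ<)
open import Data.Fin.Properties
  using (_≟_; any?; suc-injective; injective⇒≤; punchIn-injective;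
         punchInᵢ≢i; combine-remQuot)
open import Data.Fin.Subset using (Subset; _∈_; ∣_∣)
open import Data.Product using (∃; _×_; _,_; proj₁; proj₂; uncurry)
open import Data.Rational using (1ℚ)
open import Data.Vec.Base using ([]; _∷_; here; there; lookup)
open import Data.Vec.Properties using ([]=⇒lookup; lookup∘tabulate)
open import Data.Vec.Relation.Unary.All using ([]; _∷_)
open import Data.Vec.Relation.Unary.AllPairs using ([]; _∷_)
open import Data.Vec.Relation.Unary.Unique.Propositional.Properties
  using (lookup-injective)
open import Function.Base using (_∘_)
open import Function.Definitions using (Injective)
open import Relation.Nullary using (¬_; Dec; yes; no; does; contradiction)
open import Relation.Binary.PropositionalEquality
  using (_≡_; _≢_; refl; trans; cong; subst; ≢-sym)
  renaming (sym to ≡-sym)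

-- Exactly `d` members are listed even when `p` has more, so that the neighbour lists of vertices of
-- different degrees share one index type.
enumerate : ∀ {n d} (p : Subset n) → d ≤ ∣ p ∣ →
            ∃ λ (f : Fin d → Fin n) → Injective _≡_ _≡_ f × (∀ i → f i ∈ p)
enumerate {d = 0} p _ = (λ ()) , (λ { {()} }) , λ ()
enumerate {d = suc d} (false ∷ p) d≤ with enumerate p d≤
... | f , f-inj , f∈p = suc ∘ f , f-inj ∘ suc-injective , there ∘ f∈p
enumerate {n = suc n} {d = suc d} (true ∷ p) (s≤s d≤) with enumerate p d≤
... | f , f-inj , f∈p = f′ , f′-inj , f′∈
  where
  f′ : Fin (suc d) → Fin (suc n)
  f′ zero    = zero
  f′ (suc i) = suc (f i)

  f′-inj : Injective _≡_ _≡_ f′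
  f′-inj {zero}  {zero}  _  = refl
  f′-inj {suc i} {suc j} eq = cong suc (f-inj (suc-injective eq))

  f′∈ : ∀ i → f′ i ∈ (true ∷ p)
  f′∈ zero    = here
  f′∈ (suc i) = there (f∈p i)

-- Serves to strike `v` from the neighbour list of a neighbour of `v`. Skipping an index through
-- `punchIn` keeps the remaining list injective.
omit : ∀ {n e} (f : Fin (suc e) → Fin n) → Injective _≡_ _≡_ f → ∀ v →
       ∃ λ i → ∀ j → f (punchIn i j) ≢ v
omit f f-inj v with any? (λ i → f i ≟ v)
... | yes (i , fi≡v) = i , λ j eq →
  punchInᵢ≢i i j (f-inj (trans eq (≡-sym fi≡v)))
-- Nothing has to be avoided here; an index is dropped all the same, so that `e` values remain in
-- both cases.
... | no ∄i = zero , λ j eq → ∄i (suc j , eq)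

∈-neighbours : ∀ {n} (G : Graph n) {v u} → u ∈ neighbours G v → Adj G v u
∈-neighbours G {v} {u} u∈ = extract (adj? G v u)
  (trans (≡-sym (lookup∘tabulate _ u)) ([]=⇒lookup u∈))
  where
  extract : ∀ {A : Set} (A? : Dec A) → does A? ≡ true → A
  extract (yes a) _ = a

Adj⇒≢ : ∀ {n} (G : Graph n) {u v} → Adj G u v → u ≢ v
Adj⇒≢ G uv u≡v = irrefl G u≡v uv

-- Consecutive vertices differ by irreflexivity, so distinctness is assumed only across the two
-- diagonals.
fourCycle : ∀ {n} (G : Graph n) {v a w b} →
            Adj G v a → Adj G a w → Adj G w b → Adj G b v →
            v ≢ w → a ≢ b → Cycle G 4
fourCycle G {v} {a} {w} {b} va aw wb bv v≢w a≢b = record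
  { 3≤length = s≤s (s≤s (s≤s z≤n))
  ; vertex   = lookup vs
  ; distinct = lookup-injective unique _ _
  ; step     = step′
  ; close    = close′
  }
  where
  vs = v ∷ a ∷ w ∷ b ∷ []

  unique = (Adj⇒≢ G va ∷ v≢w ∷ ≢-sym (Adj⇒≢ G bv) ∷ [])
         ∷ (Adj⇒≢ G aw ∷ a≢b ∷ [])
         ∷ (Adj⇒≢ G wb ∷ [])
         ∷ [] ∷ []

  step′ : ∀ i j → toℕ j ≡ suc (toℕ i) → Adj G (lookup vs i) (lookup vs j)
  step′ zero                (suc zero)             _ = va
  step′ (suc zero)          (suc (suc zero))       _ = aw
  step′ (suc (suc zero))    (suc (suc (suc zero))) _ = wb

  close′ : ∀ i j → suc (toℕ i) ≡ 4 → toℕ j ≡ 0 →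
           Adj G (lookup vs i) (lookup vs j)
  close′ (suc (suc (suc zero))) zero _ _ = bv

-- A vertex v, its neighbours a i, and the neighbours b i j ≢ v of those: two
-- coinciding b's reached through different a's would close a 4-cycle at v.
noFourCycle⇒minDegree : ∀ {n} (G : Graph n) → ¬ Cycle G 4 → Fin n → ∀ {e} →
                        (∀ v → e < degree G v) → suc e * e ≤ n
noFourCycle⇒minDegree {n} G noC₄ v {e} e<deg = injective⇒≤ h-inj
  where
  nbr : ∀ u → ∃ λ (f : Fin (suc e) → Fin n) →
              Injective _≡_ _≡_ f × (∀ i → f i ∈ neighbours G u)
  nbr u = enumerate (neighbours G u) (e<deg u)

  a : Fin (suc e) → Fin n
  a = proj₁ (nbr v)

  va : ∀ i → Adj G v (a i)
  va = ∈-neighbours G ∘ proj₂ (proj₂ (nbr v))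

  f : ∀ i → Fin (suc e) → Fin n
  f i = proj₁ (nbr (a i))

  f-inj : ∀ i → Injective _≡_ _≡_ (f i)
  f-inj i = proj₁ (proj₂ (nbr (a i)))

  back : ∀ i → ∃ λ k → ∀ j → f i (punchIn k j) ≢ v
  back i = omit (f i) (f-inj i) v

  b : Fin (suc e) → Fin e → Fin n
  b i = f i ∘ punchIn (proj₁ (back i))

  ab : ∀ i j → Adj G (a i) (b i j)
  ab i j = ∈-neighbours G (proj₂ (proj₂ (nbr (a i))) _)

  b-inj : ∀ i j i′ j′ → b i j ≡ b i′ j′ → (i , j) ≡ (i′ , j′)
  b-inj i j i′ j′ eq with i ≟ i′
  ... | yes refl = cong (i ,_) (punchIn-injective _ j j′ (f-inj i eq))
  ... | no i≢i′  = contradiction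
    -- The cycle is `v`, `a i`, `b i j`, `a i′`, where `eq` turns the edge at `b i′ j′` into the
    -- third one. The diagonals have distinct ends by `back` and by injectivity of `a`.
    (fourCycle G (va i) (ab i j)
      (subst (λ w → Adj G w (a i′)) (≡-sym eq) (sym G (ab i′ j′)))
      (sym G (va i′))
      (≢-sym (proj₂ (back i) j))
      (i≢i′ ∘ proj₁ (proj₂ (nbr v))))
    noC₄

  h : Fin (suc e * e) → Fin n
  h = uncurry b ∘ remQuot e

  h-inj : Injective _≡_ _≡_ h
  -- `combine` undoes `remQuot`, so it suffices that the decoded pairs agree.
  h-inj {x} {y} eq = trans (≡-sym (combine-remQuot {suc e} e x))
    (trans (cong (uncurry combine) (b-inj _ _ _ _ eq))
           (combine-remQuot {suc e} e y))

-- With `g = 3 + h`, the right side minus the left is a polynomial in `q` and `h` with nonnegative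
-- coefficients. At `g = 2`, `q = 0` the inequality would read 3 ≤ 2.
quotient-bound : ∀ q g → 3 ≤ g →
                 suc q * suc g ≤ suc (q + g ∸ 1) * (q + g ∸ 1)
quotient-bound q (suc (suc (suc h))) _
  -- Exposes a successor, so that `∸ 1` computes.
  rewrite +-suc q (suc (suc h)) =
  subst (suc q * (4 + h) ≤_) (expand q h)
    -- The summand added is exactly that difference.
    (m≤m+n _ (h * h + 4 * h + 2 + (q + h * q + q * q)))
  where
  expand : ∀ q h → suc q * (4 + h) + (h * h + 4 * h + 2 + (q + h * q + q * q))
                   ≡ suc (q + (2 + h)) * (q + (2 + h))
  expand = solve-∀
quotient-bound _ (suc 0) (s≤s ())
quotient-bound _ (suc (suc 0)) (s≤s (s≤s ()))

theorem1p6 : ∀ {n : ℕ} (G : Graph n) (g : ℕ) →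
    MinimallyTough G 1ℚ → HasGirth G g → 5 ≤ g →
    ∃ λ (v : Fin n) → degree G v ≤ (n / suc g + g) ∸ 1
theorem1p6 {n} G g _ (C , shortest) 5≤g
  with any? (λ v → degree G v ≤? (n / suc g + g) ∸ 1)
... | yes found = found
... | no ∄v = contradiction
  -- If all degrees exceed the bound, then `suc (n / suc g) * suc g ≤ n`; but the remainder of `n`
  -- is less than `suc g`.
  (≤-trans (quotient-bound (n / suc g) g 3≤g)
    (noFourCycle⇒minDegree G noC₄ v₀ λ v → ≰⇒> λ small → ∄v (v , small)))
  (<⇒≱ (subst (_< suc (n / suc g) * suc g) (≡-sym (m≡m%n+[m/n]*n n (suc g)))
    (+-monoˡ-< (n / suc g * suc g) (m%n<n n (suc g)))))
  where
  open Cycle C using (vertex) renaming (3≤length to 3≤g)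

  -- The count needs a vertex to start from; a shortest cycle supplies one.
  v₀ : Fin n
  v₀ = vertex (fromℕ< (≤-trans (s≤s z≤n) 3≤g))

  noC₄ : ¬ Cycle G 4
  noC₄ C₄ = <⇒≱ 5≤g (shortest 4 C₄)
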